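{- For every $\delta\in(0,1]$ there is a constant $c_\delta>0$ such that the following holds. Let $A=\{a_1<a_2<\dots<a_k\}\subset\mathbb{R}$ and let $D=\{a_{i+1}-a_i: 1\le i\le k-1\}$ be its set of consecutive differences. If $|D|\ge \delta|A|$, then for every finite nonempty $B\subset\mathbb{R}$, \[ |A+B|\ge c_\delta\,|A|\,|B|^{1/2}. \]
   Context: For finite $A,B\subset\mathbb{R}$, $A+B=\{a+b: a\in A, b\in B\}$. -}

module Defs where

open import Data.Fin.Base as Fin using (Fin; zero; suc; toℕ)
import Data.Fin.Properties as Fin
open import Data.Integer.Base as ℤ using (+_)
import Data.Integer.Properties as ℤ
open import Data.Nat.Base as ℕ using (ℕ; zero; suc)
import Data.Nat.Properties as ℕ
import Data.Nat.Coprimality as Coprimality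
open import Data.Product using (Σ; _×_; _,_; proj₁; proj₂; ∃; ∃-syntax)
open import Data.Rational.Base as ℚ using (ℚ; 0ℚ; 1ℚ; ½; ∣_∣)
import Data.Rational.Properties as ℚ
open import Data.Rational.Solver using (module +-*-Solver)
import Data.Rational.Unnormalised.Base as ℚᵘ
import Data.Rational.Unnormalised.Properties as ℚᵘ
open import Data.Sum.Base using (inj₁; inj₂)
open import Function.Base using (_∘_)
open import Function.Bundles using (_⇔_; mk⇔; Equivalence)
open import Function.Definitions using (Injective)
open import Level using (0ℓ)
open import Relation.Binary.Definitions using (tri<; tri≈; tri>)
open import Relation.Binary.PropositionalEquality
  using (_≡_; refl; sym; trans; cong; cong₂; subst; subst₂)
open import Relation.Nullary using (¬_; yes; no; contradiction)
open import Relation.Unary using (Pred)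

private
  half-sum : ∀ ε → ½ ℚ.* ε ℚ.+ ½ ℚ.* ε ≡ ε
  half-sum ε = trans (sym (ℚ.*-distribʳ-+ ε ½ ½)) (ℚ.*-identityˡ ε)

  *-pos : ∀ {p q} → 0ℚ ℚ.< p → 0ℚ ℚ.< q → 0ℚ ℚ.< p ℚ.* q
  *-pos {p} {q} 0<p 0<q = subst (ℚ._< p ℚ.* q) (ℚ.*-zeroʳ p)
    (ℚ.*-monoʳ-<-pos p {{ℚ.positive 0<p}} 0<q)

  half-pos : ∀ {ε} → 0ℚ ℚ.< ε → 0ℚ ℚ.< ½ ℚ.* ε
  half-pos 0<ε = *-pos (ℚ.positive⁻¹ ½) 0<ε

  +-halves : ∀ {p q ε} → p ℚ.< ½ ℚ.* ε → q ℚ.< ½ ℚ.* ε → p ℚ.+ q ℚ.< ε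
  +-halves {p} {q} {ε} p< q< =
    subst (p ℚ.+ q ℚ.<_) (half-sum ε) (ℚ.+-mono-< p< q<)

  *-mono-≤ : ∀ {p q r s} → 0ℚ ℚ.≤ p → 0ℚ ℚ.≤ s →
             p ℚ.≤ q → r ℚ.≤ s → p ℚ.* r ℚ.≤ q ℚ.* s
  *-mono-≤ {p} {q} {r} {s} 0≤p 0≤s p≤q r≤s = ℚ.≤-trans
    (ℚ.*-monoˡ-≤-nonNeg p {{ℚ.nonNegative 0≤p}} r≤s)
    (ℚ.*-monoʳ-≤-nonNeg s {{ℚ.nonNegative 0≤s}} p≤q)

  -- A factor bounded by K can be absorbed by shrinking ε.
  shrink : ∀ {K ε} → 0ℚ ℚ.< K → 0ℚ ℚ.< ε →
           Σ ℚ λ η → 0ℚ ℚ.< η × K ℚ.* η ≡ ε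
  shrink {K} {ε} 0<K 0<ε = K⁻¹ ℚ.* ε , *-pos 0<K⁻¹ 0<ε ,
    trans (sym (ℚ.*-assoc K K⁻¹ ε))
      (trans (cong (ℚ._* ε) (ℚ.*-inverseʳ K)) (ℚ.*-identityˡ ε))
    where
    instance
      K>0 : ℚ.Positive K
      K>0 = ℚ.positive 0<K
      K≢0 : ℚ.NonZero K
      K≢0 = ℚ.pos⇒nonZero K
    K⁻¹ = ℚ.1/ K
    0<K⁻¹ : 0ℚ ℚ.< K⁻¹
    0<K⁻¹ = ℚ.positive⁻¹ K⁻¹ {{ℚ.1/pos⇒pos K}}

  ∣p-q∣-sym : ∀ p q → ∣ p ℚ.- q ∣ ≡ ∣ q ℚ.- p ∣
  ∣p-q∣-sym p q = trans (sym (ℚ.∣-p∣≡∣p∣ (p ℚ.- q)))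
    (cong ∣_∣ (solve 2 (λ p q → :- (p :- q) := q :- p) refl p q))
    where open +-*-Solver

  ∣p-r∣≤ : ∀ p q r → ∣ p ℚ.- r ∣ ℚ.≤ ∣ p ℚ.- q ∣ ℚ.+ ∣ q ℚ.- r ∣
  ∣p-r∣≤ p q r = subst (λ t → ∣ t ∣ ℚ.≤ ∣ p ℚ.- q ∣ ℚ.+ ∣ q ℚ.- r ∣)
    (solve 3 (λ p q r → (p :- q) :+ (q :- r) := p :- r) refl p q r)
    (ℚ.∣p+q∣≤∣p∣+∣q∣ (p ℚ.- q) (q ℚ.- r))
    where open +-*-Solver

  p≤∣p∣ : ∀ p → p ℚ.≤ ∣ p ∣
  p≤∣p∣ p with ℚ.≤-total 0ℚ p
  ... | inj₁ 0≤p = ℚ.≤-reflexive (sym (ℚ.0≤p⇒∣p∣≡p 0≤p))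
  ... | inj₂ p≤0 = ℚ.≤-trans p≤0 (ℚ.0≤∣p∣ p)

  ∣p-q∣< : ∀ {p q ε} → p ℚ.< q ℚ.+ ε → q ℚ.< p ℚ.+ ε → ∣ p ℚ.- q ∣ ℚ.< ε
  ∣p-q∣< {p} {q} {ε} p< q< with ℚ.∣p∣≡p∨∣p∣≡-p (p ℚ.- q)
  ... | inj₁ eq = subst₂ ℚ._<_ (sym eq)
      (solve 2 (λ q e → (q :+ e) :- q := e) refl q ε)
      (ℚ.+-monoˡ-< (ℚ.- q) p<)
    where open +-*-Solver
  ... | inj₂ eq = subst₂ ℚ._<_
      (trans (solve 2 (λ p q → q :- p := :- (p :- q)) refl p q) (sym eq))
      (solve 2 (λ p e → (p :+ e) :- p := e) refl p ε)
      (ℚ.+-monoˡ-< (ℚ.- p) q<)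
    where open +-*-Solver

Eventually : Pred (ℕ → Set) 0ℓ
Eventually P = ∃[ N ] ∀ n → N ℕ.≤ n → P n

private
  both : ∀ {P Q : ℕ → Set} → Eventually P → Eventually Q →
         Eventually (λ n → P n × Q n)
  both (M , p) (N , q) = M ℕ.⊔ N , λ n ≤n →
    p n (ℕ.≤-trans (ℕ.m≤m⊔n M N) ≤n) , q n (ℕ.≤-trans (ℕ.m≤n⊔m M N) ≤n)

  witness : ∀ {P : ℕ → Set} → Eventually P → ∃ P
  witness (N , p) = N , p N ℕ.≤-refl

-- The reals as Cauchy sequences of rationals.  There is no quotient: real
-- equality is _≈_ below, not _≡_.
record ℝ : Set where
  constructor mkℝ
  field
    seq    : ℕ → ℚ
    cauchy : ∀ ε → 0ℚ ℚ.< ε →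
             ∃[ N ] ∀ m n → N ℕ.≤ m → N ℕ.≤ n → ∣ seq m ℚ.- seq n ∣ ℚ.< ε

open ℝ public

infix 4 _≈_ _<_ _≤_
infix 8 -_
infixl 7 _*_
infixl 6 _+_ _-_

_≈_ : ℝ → ℝ → Set
x ≈ y = ∀ ε → 0ℚ ℚ.< ε → Eventually λ n → ∣ seq x n ℚ.- seq y n ∣ ℚ.< ε

_<_ : ℝ → ℝ → Set
x < y = ∃[ ε ] 0ℚ ℚ.< ε × Eventually λ n → seq x n ℚ.+ ε ℚ.≤ seq y n

_≤_ : ℝ → ℝ → Set
x ≤ y = ¬ (y < x)

fromℚ : ℚ → ℝ
fromℚ q = mkℝ (λ _ → q) λ ε 0<ε → 0 , λ _ _ _ _ →
  subst (ℚ._< ε) (cong ∣_∣ (sym (ℚ.+-inverseʳ q))) 0<ε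

fromℕ : ℕ → ℝ
fromℕ n = fromℚ (+ n ℚ./ 1)

0ℝ 1ℝ : ℝ
0ℝ = fromℚ 0ℚ
1ℝ = fromℚ 1ℚ

_+_ : ℝ → ℝ → ℝ
x + y = mkℝ (λ n → seq x n ℚ.+ seq y n) λ ε 0<ε →
  let M , p = cauchy x (½ ℚ.* ε) (half-pos 0<ε)
      N , q = cauchy y (½ ℚ.* ε) (half-pos 0<ε)
  in M ℕ.⊔ N , λ m n ≤m ≤n → ℚ.≤-<-trans
       (step (seq x m) (seq x n) (seq y m) (seq y n))
       (+-halves
         (p m n (ℕ.≤-trans (ℕ.m≤m⊔n M N) ≤m) (ℕ.≤-trans (ℕ.m≤m⊔n M N) ≤n))
         (q m n (ℕ.≤-trans (ℕ.m≤n⊔m M N) ≤m) (ℕ.≤-trans (ℕ.m≤n⊔m M N) ≤n)))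
  where
  open +-*-Solver
  step : ∀ a a′ b b′ → ∣ (a ℚ.+ b) ℚ.- (a′ ℚ.+ b′) ∣
                       ℚ.≤ ∣ a ℚ.- a′ ∣ ℚ.+ ∣ b ℚ.- b′ ∣
  step a a′ b b′ = subst (λ t → ∣ t ∣ ℚ.≤ ∣ a ℚ.- a′ ∣ ℚ.+ ∣ b ℚ.- b′ ∣)
    (solve 4 (λ a a′ b b′ → (a :- a′) :+ (b :- b′) := (a :+ b) :- (a′ :+ b′))
      refl a a′ b b′)
    (ℚ.∣p+q∣≤∣p∣+∣q∣ (a ℚ.- a′) (b ℚ.- b′))

-_ : ℝ → ℝ
- x = mkℝ (λ n → ℚ.- seq x n) λ ε 0<ε →
  let N , p = cauchy x ε 0<ε
  in N , λ m n ≤m ≤n → subst (ℚ._< ε) (step (seq x m) (seq x n)) (p m n ≤m ≤n)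
  where
  open +-*-Solver
  step : ∀ a b → ∣ a ℚ.- b ∣ ≡ ∣ ℚ.- a ℚ.- (ℚ.- b) ∣
  step a b = trans (∣p-q∣-sym a b)
    (cong ∣_∣ (solve 2 (λ a b → b :- a := :- a :- (:- b)) refl a b))

_-_ : ℝ → ℝ → ℝ
x - y = x + (- y)

private
  bounded : ∀ x → ∃[ K ] 0ℚ ℚ.< K × Eventually λ n → ∣ seq x n ∣ ℚ.≤ K
  bounded x =
    let N , p = cauchy x 1ℚ (ℚ.positive⁻¹ 1ℚ)
        b = seq x N
    in 1ℚ ℚ.+ ∣ b ∣ , ℚ.+-mono-<-≤ (ℚ.positive⁻¹ 1ℚ) (ℚ.0≤∣p∣ b) ,
       N , λ n ≤n → ℚ.≤-trans (step (seq x n) b)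
         (ℚ.+-monoˡ-≤ ∣ b ∣ (ℚ.<⇒≤ (p n N ≤n ℕ.≤-refl)))
    where
    open +-*-Solver
    step : ∀ a b → ∣ a ∣ ℚ.≤ ∣ a ℚ.- b ∣ ℚ.+ ∣ b ∣
    step a b = subst (λ t → ∣ t ∣ ℚ.≤ ∣ a ℚ.- b ∣ ℚ.+ ∣ b ∣)
      (solve 2 (λ a b → (a :- b) :+ b := a) refl a b)
      (ℚ.∣p+q∣≤∣p∣+∣q∣ (a ℚ.- b) b)

_*_ : ℝ → ℝ → ℝ
x * y = mkℝ (λ n → seq x n ℚ.* seq y n) isCauchy
  where
  open +-*-Solver
  step : ∀ a a′ b b′ → ∣ a ℚ.* b ℚ.- a′ ℚ.* b′ ∣
                       ℚ.≤ ∣ a ∣ ℚ.* ∣ b ℚ.- b′ ∣ ℚ.+ ∣ b′ ∣ ℚ.* ∣ a ℚ.- a′ ∣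
  step a a′ b b′ = subst₂ ℚ._≤_
    (cong ∣_∣ (solve 4 (λ a a′ b b′ →
      a :* (b :- b′) :+ b′ :* (a :- a′) := a :* b :- a′ :* b′) refl a a′ b b′))
    (cong₂ ℚ._+_ (ℚ.∣p*q∣≡∣p∣*∣q∣ a (b ℚ.- b′)) (ℚ.∣p*q∣≡∣p∣*∣q∣ b′ (a ℚ.- a′)))
    (ℚ.∣p+q∣≤∣p∣+∣q∣ (a ℚ.* (b ℚ.- b′)) (b′ ℚ.* (a ℚ.- a′)))

  scale : ∀ {a b K η ε} → 0ℚ ℚ.< K → K ℚ.* η ≡ ε →
          ∣ a ∣ ℚ.≤ K → ∣ b ∣ ℚ.< η → ∣ a ∣ ℚ.* ∣ b ∣ ℚ.< ε
  scale {a} {b} {K} 0<K refl a≤ b< = ℚ.≤-<-trans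
    (ℚ.*-monoʳ-≤-nonNeg ∣ b ∣ {{ℚ.∣-∣-nonNeg b}} a≤)
    (ℚ.*-monoʳ-<-pos K {{ℚ.positive 0<K}} b<)

  isCauchy : ∀ ε → 0ℚ ℚ.< ε → ∃[ N ] ∀ m n → N ℕ.≤ m → N ℕ.≤ n →
             ∣ seq x m ℚ.* seq y m ℚ.- seq x n ℚ.* seq y n ∣ ℚ.< ε
  isCauchy ε 0<ε =
    let K , 0<K , M₁ , x≤K = bounded x
        L , 0<L , M₂ , y≤L = bounded y
        η , 0<η , Kη = shrink 0<K (half-pos 0<ε)
        θ , 0<θ , Lθ = shrink 0<L (half-pos 0<ε)
        N₁ , p = cauchy x θ 0<θ
        N₂ , q = cauchy y η 0<η
        M = M₁ ℕ.⊔ M₂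
        N = N₁ ℕ.⊔ N₂
        M≤ = λ {m} → ℕ.≤-trans {k = m} (ℕ.m≤m⊔n M N)
        N≤ = λ {m} → ℕ.≤-trans {k = m} (ℕ.m≤n⊔m M N)
    in M ℕ.⊔ N , λ m n ≤m ≤n → ℚ.≤-<-trans
         (step (seq x m) (seq x n) (seq y m) (seq y n))
         (+-halves
           (scale {seq x m} {seq y m ℚ.- seq y n} 0<K Kη
             (x≤K m (ℕ.≤-trans (ℕ.m≤m⊔n M₁ M₂) (M≤ ≤m)))
             (q m n (ℕ.≤-trans (ℕ.m≤n⊔m N₁ N₂) (N≤ ≤m))
                    (ℕ.≤-trans (ℕ.m≤n⊔m N₁ N₂) (N≤ ≤n))))
           (scale {seq y n} {seq x m ℚ.- seq x n} 0<L Lθ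
             (y≤L n (ℕ.≤-trans (ℕ.m≤n⊔m M₁ M₂) (M≤ ≤n)))
             (p m n (ℕ.≤-trans (ℕ.m≤m⊔n N₁ N₂) (N≤ ≤m))
                    (ℕ.≤-trans (ℕ.m≤m⊔n N₁ N₂) (N≤ ≤n)))))

≈-refl : ∀ {x} → x ≈ x
≈-refl {x} ε 0<ε = 0 , λ n _ →
  subst (ℚ._< ε) (cong ∣_∣ (sym (ℚ.+-inverseʳ (seq x n)))) 0<ε

≈-sym : ∀ {x y} → x ≈ y → y ≈ x
≈-sym {x} {y} x≈y ε 0<ε =
  let N , p = x≈y ε 0<ε
  in N , λ n ≤n → subst (ℚ._< ε) (∣p-q∣-sym (seq x n) (seq y n)) (p n ≤n)

≈-trans : ∀ {x y z} → x ≈ y → y ≈ z → x ≈ z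
≈-trans {x} {y} {z} x≈y y≈z ε 0<ε =
  let N , p = both (x≈y (½ ℚ.* ε) (half-pos 0<ε)) (y≈z (½ ℚ.* ε) (half-pos 0<ε))
  in N , λ n ≤n → ℚ.≤-<-trans (∣p-r∣≤ (seq x n) (seq y n) (seq z n))
       (+-halves (proj₁ (p n ≤n)) (proj₂ (p n ≤n)))

<⇒≉ : ∀ {x y} → x < y → ¬ (x ≈ y)
<⇒≉ {x} {y} (ε , 0<ε , ev) x≈y =
  let n , x+ε≤y , ∣x-y∣<ε = witness (both ev (x≈y ε 0<ε))
  in ℚ.<-irrefl refl (ℚ.≤-<-trans (step (seq x n) (seq y n) ε x+ε≤y) ∣x-y∣<ε)
  where
  open +-*-Solver
  step : ∀ a b ε → a ℚ.+ ε ℚ.≤ b → ε ℚ.≤ ∣ a ℚ.- b ∣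
  step a b ε a+ε≤b = ℚ.≤-trans
    (subst (ℚ._≤ b ℚ.- a) (solve 2 (λ a e → (a :+ e) :- a := e) refl a ε)
      (ℚ.+-monoˡ-≤ (ℚ.- a) a+ε≤b))
    (ℚ.≤-trans (p≤∣p∣ (b ℚ.- a)) (ℚ.≤-reflexive (∣p-q∣-sym b a)))

-- ⌊√n⌋
isqrt : ℕ → ℕ
isqrt zero = zero
isqrt (suc n) with suc (isqrt n) ℕ.* suc (isqrt n) ℕ.≤? suc n
... | yes _ = suc (isqrt n)
... | no  _ = isqrt n

isqrt-≤ : ∀ n → isqrt n ℕ.* isqrt n ℕ.≤ n
isqrt-≤ zero = ℕ.z≤n
isqrt-≤ (suc n) with suc (isqrt n) ℕ.* suc (isqrt n) ℕ.≤? suc n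
... | yes p = p
... | no  _ = ℕ.m≤n⇒m≤1+n (isqrt-≤ n)

isqrt-> : ∀ n → n ℕ.< suc (isqrt n) ℕ.* suc (isqrt n)
isqrt-> zero = ℕ.s≤s ℕ.z≤n
isqrt-> (suc n) with suc (isqrt n) ℕ.* suc (isqrt n) ℕ.≤? suc n
... | no ¬p = ℕ.≰⇒> ¬p
... | yes p = ℕ.≤-<-trans (isqrt-> n)
  (ℕ.*-mono-< (ℕ.n<1+n (suc (isqrt n))) (ℕ.n<1+n (suc (isqrt n))))

private
  ι : ℕ → ℚ
  ι n = + n ℚ./ 1

  u : ℕ → ℚ
  u k = + 1 ℚ./ suc k

  ιᵘ : ∀ n → ℚ.toℚᵘ (ι n) ℚᵘ.≃ ℚᵘ.mkℚᵘ (+ n) 0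
  ιᵘ n = ℚ.toℚᵘ-fromℚᵘ (ℚᵘ.mkℚᵘ (+ n) 0)

  ι-+ : ∀ m n → ι (m ℕ.+ n) ≡ ι m ℚ.+ ι n
  ι-+ m n = ℚ.toℚᵘ-injective (ℚᵘ.≃-trans (ιᵘ (m ℕ.+ n)) (ℚᵘ.≃-trans
    (ℚᵘ.*≡* (cong (ℤ._* + 1) (sym (cong₂ ℤ._+_
      (ℤ.*-identityʳ (+ m)) (ℤ.*-identityʳ (+ n))))))
    (ℚᵘ.≃-sym (ℚᵘ.≃-trans (ℚ.toℚᵘ-homo-+ (ι m) (ι n))
      (ℚᵘ.+-cong (ιᵘ m) (ιᵘ n))))))

  ι-* : ∀ m n → ι (m ℕ.* n) ≡ ι m ℚ.* ι n
  ι-* m n = ℚ.toℚᵘ-injective (ℚᵘ.≃-trans (ιᵘ (m ℕ.* n)) (ℚᵘ.≃-trans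
    (ℚᵘ.*≡* (cong (ℤ._* + 1) (ℤ.pos-* m n)))
    (ℚᵘ.≃-sym (ℚᵘ.≃-trans (ℚ.toℚᵘ-homo-* (ι m) (ι n))
      (ℚᵘ.*-cong (ιᵘ m) (ιᵘ n))))))

  ι-< : ∀ {m n} → m ℕ.< n → ι m ℚ.< ι n
  ι-< {m} {n} m<n = ℚ.toℚᵘ-cancel-<
    (ℚᵘ.<-respˡ-≃ (ℚᵘ.≃-sym (ιᵘ m)) (ℚᵘ.<-respʳ-≃ (ℚᵘ.≃-sym (ιᵘ n))
      (ℚᵘ.*<* (ℤ.*-monoʳ-<-pos (+ 1) (ℤ.+<+ m<n)))))

  ι-≤ : ∀ {m n} → m ℕ.≤ n → ι m ℚ.≤ ι n
  ι-≤ {m} {n} m≤n = ℚ.toℚᵘ-cancel-≤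
    (ℚᵘ.≤-respˡ-≃ (ℚᵘ.≃-sym (ιᵘ m)) (ℚᵘ.≤-respʳ-≃ (ℚᵘ.≃-sym (ιᵘ n))
      (ℚᵘ.*≤* (ℤ.*-monoʳ-≤-nonNeg (+ 1) (ℤ.+≤+ m≤n)))))

  u′ : ∀ k → u k ≡ ℚ.mkℚ (+ 1) k (Coprimality.1-coprimeTo (suc k))
  u′ k = ℚ.normalize-coprime (Coprimality.1-coprimeTo (suc k))

  u-pos : ∀ k → 0ℚ ℚ.< u k
  u-pos k = subst (0ℚ ℚ.<_) (sym (u′ k)) (ℚ.positive⁻¹ _)

  u-inv : ∀ k → ι (suc k) ℚ.* u k ≡ 1ℚ
  u-inv k = ℚ.toℚᵘ-injective (ℚᵘ.≃-trans (ℚ.toℚᵘ-homo-* (ι (suc k)) (u k))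
    (ℚᵘ.≃-trans (ℚᵘ.*-cong (ιᵘ (suc k)) (ℚ.toℚᵘ-fromℚᵘ (ℚᵘ.mkℚᵘ (+ 1) k)))
      (ℚᵘ.*≡* (trans (ℤ.*-identityʳ (+ suc k ℤ.* + 1))
        (trans (ℤ.*-comm (+ suc k) (+ 1))
          (cong (λ t → + 1 ℤ.* + t) (sym (ℕ.*-identityˡ (suc k)))))))))

  u→0 : ∀ ε → 0ℚ ℚ.< ε → Eventually λ k → u k ℚ.< ε
  u→0 (ℚ.mkℚ (ℤ.+[1+ p ]) d _) _ = suc d , λ k d<k →
    subst (ℚ._< _) (sym (u′ k)) (ℚ.*<* (ℤ.+<+ (begin-strict
      1 ℕ.* suc d         ≡⟨ ℕ.*-identityˡ (suc d) ⟩
      suc d               ≤⟨ d<k ⟩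
      k                   <⟨ ℕ.n<1+n k ⟩
      suc k               ≤⟨ ℕ.m≤m+n (suc k) (p ℕ.* suc k) ⟩
      suc p ℕ.* suc k     ∎)))
    where open ℕ.≤-Reasoning
  u→0 (ℚ.mkℚ (ℤ.+ zero) d _) 0<ε with 0<ε
  ... | ℚ.*<* (ℤ.+<+ ())
  u→0 (ℚ.mkℚ ℤ.-[1+ _ ] d _) 0<ε with 0<ε
  ... | ℚ.*<* ()

  square-cancel-< : ∀ {p q} → 0ℚ ℚ.≤ q → p ℚ.* p ℚ.< q ℚ.* q → p ℚ.< q
  square-cancel-< {p} {q} 0≤q pp<qq with p ℚ.<? q
  ... | yes p<q = p<q
  ... | no  p≮q = contradiction
    (ℚ.<-≤-trans pp<qq (*-mono-≤ 0≤q (ℚ.≤-trans 0≤q q≤p) q≤p q≤p))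
    (ℚ.<-irrefl refl)
    where q≤p = ℚ.≮⇒≥ p≮q

-- ⌊√(n (k+1)²)⌋ / (k+1), within 1/(k+1) below √n.
√approx : ℕ → ℕ → ℚ
√approx n k = (+ isqrt (n ℕ.* (suc k ℕ.* suc k))) ℚ./ 1 ℚ.* (+ 1 ℚ./ suc k)

private
  module _ (n k : ℕ) where
    private
      r = isqrt (n ℕ.* (suc k ℕ.* suc k))
      s = √approx n k
      open +-*-Solver

      sq-ι : ∀ m → ι (m ℕ.* m) ℚ.* (u k ℚ.* u k) ≡ (ι m ℚ.* u k) ℚ.* (ι m ℚ.* u k)
      sq-ι m = trans (cong (ℚ._* (u k ℚ.* u k)) (ι-* m m))
        (solve 2 (λ m u → (m :* m) :* (u :* u) := (m :* u) :* (m :* u))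
          refl (ι m) (u k))

      unscale : ι (n ℕ.* (suc k ℕ.* suc k)) ℚ.* (u k ℚ.* u k) ≡ ι n
      unscale = trans
        (cong (ℚ._* (u k ℚ.* u k)) (ι-* n (suc k ℕ.* suc k)))
        (trans (ℚ.*-assoc (ι n) (ι (suc k ℕ.* suc k)) (u k ℚ.* u k))
        (trans (cong (ι n ℚ.*_) (trans (sq-ι (suc k))
          (cong₂ ℚ._*_ (u-inv k) (u-inv k)))) (ℚ.*-identityʳ (ι n))))

      suc-s : ι (suc r) ℚ.* u k ≡ s ℚ.+ u k
      suc-s = trans (cong (ℚ._* u k) (ι-+ 1 r))
        (trans (ℚ.*-distribʳ-+ (u k) 1ℚ (ι r))
        (trans (cong (ℚ._+ s) (ℚ.*-identityˡ (u k))) (ℚ.+-comm (u k) s)))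

      uu-pos : 0ℚ ℚ.< u k ℚ.* u k
      uu-pos = *-pos (u-pos k) (u-pos k)

    √a-nonneg : 0ℚ ℚ.≤ √approx n k
    √a-nonneg = subst (ℚ._≤ s) (ℚ.*-zeroˡ (u k))
      (ℚ.*-monoʳ-≤-nonNeg (u k) {{ℚ.nonNegative (ℚ.<⇒≤ (u-pos k))}}
        (ι-≤ {0} {r} ℕ.z≤n))

    √a-≤ : √approx n k ℚ.* √approx n k ℚ.≤ ι n
    √a-≤ = subst₂ ℚ._≤_ (sq-ι r) unscale
      (ℚ.*-monoʳ-≤-nonNeg (u k ℚ.* u k) {{ℚ.nonNegative (ℚ.<⇒≤ uu-pos)}}
        (ι-≤ (isqrt-≤ (n ℕ.* (suc k ℕ.* suc k)))))

    √a-> : ι n ℚ.< (√approx n k ℚ.+ u k) ℚ.* (√approx n k ℚ.+ u k)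
    √a-> = subst₂ ℚ._<_ unscale
      (trans (sq-ι (suc r)) (cong₂ ℚ._*_ suc-s suc-s))
      (ℚ.*-monoˡ-<-pos (u k ℚ.* u k) {{ℚ.positive uu-pos}}
        (ι-< (isqrt-> (n ℕ.* (suc k ℕ.* suc k)))))

  √a-mono : ∀ n j k → √approx n j ℚ.< √approx n k ℚ.+ u k
  √a-mono n j k = square-cancel-<
    (ℚ.+-mono-≤ (√a-nonneg n k) (ℚ.<⇒≤ (u-pos k)))
    (ℚ.≤-<-trans (√a-≤ n j) (√a-> n k))

√ : ℕ → ℝ
√ n = mkℝ (√approx n) λ ε 0<ε →
  let N , p = u→0 ε 0<ε
      close = λ j k ≤k → ℚ.<-trans (√a-mono n j k)
                (ℚ.+-monoʳ-< (√approx n k) (p k ≤k))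
  in N , λ j k ≤j ≤k → ∣p-q∣< (close j k ≤k) (close k j ≤j)

√-nonneg : ∀ n → 0ℝ ≤ √ n
√-nonneg n (ε , 0<ε , ev) =
  let k , s+ε≤0 = witness ev
  in ℚ.<-irrefl refl
       (ℚ.<-≤-trans (ℚ.+-mono-≤-< (√a-nonneg n k) 0<ε) s+ε≤0)

√-square : ∀ n → √ n * √ n ≈ fromℕ n
√-square n ε 0<ε =
  let K = (ι n ℚ.+ 1ℚ ℚ.+ 1ℚ) ℚ.+ (ι n ℚ.+ 1ℚ ℚ.+ 1ℚ)
      η , 0<η , Kη = shrink {K} (ℚ.+-mono-< 0<L 0<L) 0<ε
      N , p = both (u→0 η 0<η) (u→0 1ℚ (ℚ.positive⁻¹ 1ℚ))
  in N , λ k ≤k → ∣p-q∣<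
       (ℚ.≤-<-trans (√a-≤ n k)
         (subst (ℚ._< ι n ℚ.+ ε) (ℚ.+-identityʳ (ι n)) (ℚ.+-monoʳ-< (ι n) 0<ε)))
       (ℚ.<-≤-trans (√a-> n k) (ℚ.≤-trans
         (ℚ.≤-reflexive (expand (√approx n k) (u k)))
         (ℚ.+-monoʳ-≤ (√approx n k ℚ.* √approx n k)
           (subst ((s+s+u k) ℚ.* u k ℚ.≤_) Kη
             (*-mono-≤ (s+s+u-nonneg k) (ℚ.<⇒≤ 0<η)
               (s+s+u≤K k (ℚ.<⇒≤ (proj₂ (p k ≤k))))
               (ℚ.<⇒≤ (proj₁ (p k ≤k))))))))
  where
  open +-*-Solver
  L = ι n ℚ.+ 1ℚ ℚ.+ 1ℚ
  0≤ι : 0ℚ ℚ.≤ ι n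
  0≤ι = ι-≤ {0} {n} ℕ.z≤n
  0<1 = ℚ.positive⁻¹ 1ℚ
  0<ι+1 : 0ℚ ℚ.< ι n ℚ.+ 1ℚ
  0<ι+1 = ℚ.+-mono-≤-< 0≤ι 0<1
  0<L : 0ℚ ℚ.< L
  0<L = ℚ.+-mono-< 0<ι+1 0<1
  s+s+u : ℕ → ℚ
  s+s+u k = √approx n k ℚ.+ (√approx n k ℚ.+ u k)
  expand : ∀ s u → (s ℚ.+ u) ℚ.* (s ℚ.+ u) ≡
                   s ℚ.* s ℚ.+ (s ℚ.+ (s ℚ.+ u)) ℚ.* u
  expand s u = solve 2 (λ s u →
    (s :+ u) :* (s :+ u) := s :* s :+ (s :+ (s :+ u)) :* u) refl s u
  s+s+u-nonneg : ∀ k → 0ℚ ℚ.≤ s+s+u k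
  s+s+u-nonneg k = ℚ.+-mono-≤ (√a-nonneg n k)
    (ℚ.+-mono-≤ (√a-nonneg n k) (ℚ.<⇒≤ (u-pos k)))
  ι<[ι+1]² : ι n ℚ.< (ι n ℚ.+ 1ℚ) ℚ.* (ι n ℚ.+ 1ℚ)
  ι<[ι+1]² = subst (ι n ℚ.<_)
    (trans (ι-* (n ℕ.+ 1) (n ℕ.+ 1)) (cong₂ ℚ._*_ (ι-+ n 1) (ι-+ n 1)))
    (ι-< (ℕ.≤-trans (ℕ.≤-reflexive (ℕ.+-comm 1 n))
      (ℕ.m≤m*n (n ℕ.+ 1) (n ℕ.+ 1) {{ℕ.>-nonZero (ℕ.m≤n+m 1 n)}})))
  s<ι+1 : ∀ k → √approx n k ℚ.< ι n ℚ.+ 1ℚ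
  s<ι+1 k = square-cancel-< (ℚ.<⇒≤ 0<ι+1) (ℚ.≤-<-trans (√a-≤ n k) ι<[ι+1]²)
  s+s+u≤K : ∀ k → u k ℚ.≤ 1ℚ → s+s+u k ℚ.≤ L ℚ.+ L
  s+s+u≤K k u≤1 = ℚ.+-mono-≤
    (ℚ.≤-trans (ℚ.<⇒≤ (s<ι+1 k))
      (subst (ℚ._≤ L) (ℚ.+-identityʳ (ι n ℚ.+ 1ℚ))
        (ℚ.+-monoʳ-≤ (ι n ℚ.+ 1ℚ) (ℚ.<⇒≤ 0<1))))
    (ℚ.+-mono-≤ (ℚ.<⇒≤ (s<ι+1 k)) u≤1)

Range : ∀ {k} → (Fin k → ℝ) → Pred ℝ 0ℓ
Range f x = ∃[ i ] x ≈ f i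

-- Equality on ℝ is not decidable, so cardinality is a relation rather than a
-- function: P has exactly n elements when some enumeration without repetition
-- by Fin n has range P.
HasCard : Pred ℝ 0ℓ → ℕ → Set
HasCard P n = Σ (Fin n → ℝ) λ f → Injective _≡_ _≈_ f × (∀ x → P x ⇔ Range f x)

infixl 6 _⊕_
_⊕_ : Pred ℝ 0ℓ → Pred ℝ 0ℓ → Pred ℝ 0ℓ
(P ⊕ Q) x = ∃[ p ] ∃[ q ] P p × Q q × x ≈ p + q

StrictlyIncreasing : ∀ {k} → (Fin k → ℝ) → Set
StrictlyIncreasing a = ∀ {i j} → i Fin.< j → a i < a j

ConsecutiveDifferences : ∀ {k} → (Fin k → ℝ) → Pred ℝ 0ℓ
ConsecutiveDifferences a d =
  ∃[ i ] ∃[ j ] toℕ j ≡ suc (toℕ i) × d ≈ a j - a i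

increasing⇒HasCard : ∀ {k} (a : Fin k → ℝ) → StrictlyIncreasing a →
                     HasCard (Range a) k
increasing⇒HasCard a inc = a , inj , λ x → mk⇔ (λ p → p) (λ p → p)
  where
  inj : Injective _≡_ _≈_ a
  inj {i} {j} ai≈aj with Fin.<-cmp i j
  ... | tri< i<j _ _ = contradiction ai≈aj (<⇒≉ {a i} {a j} (inc i<j))
  ... | tri≈ _ i≡j _ = i≡j
  ... | tri> _ _ j<i =
    contradiction (≈-sym {a i} {a j} ai≈aj) (<⇒≉ {a j} {a i} (inc j<i))

private
  HasCard-≤ : ∀ {P m n} → HasCard P m → HasCard P n → m ℕ.≤ n
  HasCard-≤ {P} {m} {n} (f , f-inj , f-P) (g , g-inj , g-P) =
    Fin.injective⇒≤ {f = h} h-inj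
    where
    index : ∀ i → Range g (f i)
    index i = Equivalence.to (g-P (f i))
      (Equivalence.from (f-P (f i)) (i , ≈-refl {f i}))
    h : Fin m → Fin n
    h = proj₁ ∘ index
    h-inj : Injective _≡_ _≡_ h
    h-inj {i} {j} eq = f-inj (≈-trans {f i} {g (h j)} {f j}
      (subst (λ t → f i ≈ g t) eq (proj₂ (index i)))
      (≈-sym {f j} {g (h j)} (proj₂ (index j))))

HasCard-unique : ∀ {P m n} → HasCard P m → HasCard P n → m ≡ n
HasCard-unique {P} p q = ℕ.≤-antisym (HasCard-≤ {P} p q) (HasCard-≤ {P} q p)

-- Constructively, a list of reals cannot be pruned of repetitions, but a
-- cardinality always exists up to double negation.
Range-¬¬HasCard : ∀ {k} (f : Fin k → ℝ) → ¬ ¬ (∃[ n ] HasCard (Range f) n)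
Range-¬¬HasCard {zero} f none =
  none (0 , f , (λ { {()} }) , λ x → mk⇔ (λ p → p) (λ p → p))
Range-¬¬HasCard {suc k} f none = Range-¬¬HasCard (f ∘ suc) λ (n , g , inj , eqv) →
  let new : ¬ Range g (f zero)
      new p = none (n , g , inj , λ x → mk⇔
        (λ { (zero , x≈) → proj₁ p , ≈-trans {x} {f zero} {g (proj₁ p)} x≈ (proj₂ p)
           ; (suc i , x≈) → Equivalence.to (eqv x) (i , x≈) })
        (λ r → let i , x≈ = Equivalence.from (eqv x) r in suc i , x≈))
      g′ : Fin (suc n) → ℝ
      g′ = λ { zero → f zero ; (suc i) → g i }
      g′-inj : Injective _≡_ _≈_ g′
      g′-inj = λ { {zero} {zero} _ → refl
                 ; {zero} {suc j} e → contradiction (j , e) new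
                 ; {suc i} {zero} e →
                     contradiction (i , ≈-sym {g i} {f zero} e) new
                 ; {suc i} {suc j} e → cong suc (inj e) }
  in none (suc n , g′ , g′-inj , λ x → mk⇔
       (λ { (zero , x≈) → zero , x≈
          ; (suc i , x≈) → let j , x≈′ = Equivalence.to (eqv x) (i , x≈)
                           in suc j , x≈′ })
       (λ { (zero , x≈) → zero , x≈
          ; (suc j , x≈) → let i , x≈′ = Equivalence.from (eqv x) (j , x≈)
                           in suc i , x≈′ }))

{-# OPTIONS --safe #-}
-- For each b ∈ B the translates a₁ + b < … < a_k + b cut the sorted set S = A + B
-- into disjoint intervals, so on average few elements of S lie between a_i + b and
-- a_{i+1} + b.  Choose one i for every consecutive difference.  Then the pair
-- (a_i + b , a_{i+1} + b) determines first the difference, hence i, and then b, so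
-- there are |D||B| such pairs, at least half of which are at distance ≤ 2|S|/|D|
-- in S.  There are at most 2|S|²/|D| pairs of that kind, whence |D|²|B| ≤ 4|S|²,
-- and c = δ/2 works.
--
-- Order on ℝ is undecidable, but S is finite and the conclusion is a negation, so
-- S may be sorted under a double negation.
module Submission where

open import Defs
open import Data.Fin.Base as Fin using (Fin; toℕ; fromℕ<)
import Data.Fin.Properties as Fin
open import Data.Fin.Subset using (Subset; ∣_∣; _∈_)
open import Data.Fin.Subset.Properties using (∈⊤; ∣⊤∣≡n; p⊂q⇒∣p∣<∣q∣)
open import Data.Integer.Base as ℤ using (+_)
import Data.Integer.Properties as ℤ
open import Data.Nat.Base as ℕ using (ℕ; zero; suc; z≤n)
open import Data.Nat.DivMod using (m/n*n≤m; m≡m%n+[m/n]*n; m%n<n)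
import Data.Nat.Properties as ℕ
import Data.Nat.Solver as ℕ
open import Data.Product using (_×_; _,_; proj₁; proj₂; ∃-syntax)
open import Data.Product.Function.NonDependent.Propositional using (_×-↔_)
open import Data.Product.Properties using (,-injective)
open import Data.Rational.Base as ℚ using (ℚ; 0ℚ; 1ℚ; ½)
import Data.Rational.Properties as ℚ
import Data.Rational.Solver as ℚ
import Data.Rational.Unnormalised.Base as ℚᵘ
import Data.Rational.Unnormalised.Properties as ℚᵘ
open import Data.Sum.Base using (_⊎_; inj₁; inj₂)
open import Data.Sum.Function.Propositional using (_⊎-↔_)
open import Data.Sum.Properties using (inj₁-injective; inj₂-injective)
open import Data.Vec.Base using (tabulate)
open import Data.Vec.Properties using ([]=⇒lookup; lookup⇒[]=; lookup∘tabulate)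
open import Effect.Monad using (RawMonad)
open import Function.Base using (_∘_)
open import Function.Bundles using (_↔_; _↣_; Equivalence; Injection; mk↣)
open import Function.Construct.Composition using (_↣-∘_; _↔-∘_)
open import Function.Construct.Identity using (↔-id)
open import Function.Construct.Symmetry using (↔-sym)
open import Function.Definitions using (Injective)
open import Function.Properties.Inverse using (↔⇒↣)
open import Level using (0ℓ)
open import Relation.Binary.Core using (Rel)
open import Relation.Binary.Definitions
  using (Decidable; Transitive; tri<; tri≈; tri>)
open import Relation.Binary.PropositionalEquality
  using (_≡_; refl; sym; trans; cong; cong₂; subst; subst₂)
open import Relation.Nullary using (¬_; Dec; yes; no; does; contradiction)
open import Relation.Nullary.Decidable
  using (dec-true; decidable-stable; from-yes; ¬¬-excluded-middle)
open import Relation.Nullary.Negation using (¬¬-Monad)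
open import Relation.Unary using (Pred; Satisfiable)

-- Counting pairs of neighbours by rank.

-- Read `R i j` as the place of `a i + b j` in the sorted sumset, and `lo t`, `hi t` as the
-- neighbours chosen for difference `t`.
module Counting {k m s d : ℕ} (R : Fin k → Fin m → Fin s)
  (R-mono : ∀ {i i′} j → i Fin.< i′ → R i j Fin.< R i′ j)
  (lo hi : Fin d → Fin k) (consecutive : ∀ t → toℕ (hi t) ≡ suc (toℕ (lo t)))
  (pair-injective : ∀ {t t′ j j′} → R (lo t) j ≡ R (lo t′) j′ →
                    R (hi t) j ≡ R (hi t′) j′ → t ≡ t′ × j ≡ j′)
  where

  left right between : Fin d → Fin m → ℕ
  left t j = toℕ (R (lo t) j)
  right t j = toℕ (R (hi t) j)
  between t j = right t j ℕ.∸ suc (left t j)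

  left<right : ∀ t j → left t j ℕ.< right t j
  left<right t j = R-mono j (ℕ.≤-reflexive (sym (consecutive t)))

  left+between : ∀ t j → suc (left t j) ℕ.+ between t j ≡ right t j
  left+between t j = ℕ.m+[n∸m]≡n (left<right t j)

  R-mono-≤ : ∀ {i i′} j → i Fin.≤ i′ → R i j Fin.≤ R i′ j
  R-mono-≤ j i≤i′ with ℕ.m≤n⇒m<n∨m≡n i≤i′
  ... | inj₁ i<i′ = ℕ.<⇒≤ (R-mono j i<i′)
  ... | inj₂ i≡i′ = ℕ.≤-reflexive (cong (λ i → toℕ (R i j)) (Fin.toℕ-injective i≡i′))

  -- The `Fin m` argument provides a translate at which to compare ranks: `hi` is the successor of
  -- `lo`, so both ends agree there. Without translates `pair-injective` is vacuous.
  lo-injective : ∀ {t t′} → Fin m → lo t ≡ lo t′ → t ≡ t′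
  lo-injective {t} {t′} j eq = proj₁ (pair-injective
    (cong (λ i → R i j) eq)
    (cong (λ i → R i j) (Fin.toℕ-injective (trans (consecutive t)
      (trans (cong (suc ∘ toℕ) eq) (sym (consecutive t′)))))))

  separated : ∀ {t t′} j → lo t Fin.< lo t′ → right t j ℕ.≤ left t′ j
  separated {t} j lo<lo′ =
    R-mono-≤ j (subst (ℕ._≤ _) (sym (consecutive t)) lo<lo′)

  module _ (T : ℕ) where
    -- Each pair gets weight `T + 1`: a long gap spends its copies on distinct positions, a short
    -- gap merely carries the copy number along.
    Triple Code : Set
    Triple = Fin d × (Fin m × Fin (suc T))
    Code = (Fin s × (Fin T × Fin (suc T))) ⊎ (Fin m × Fin s)

    -- A long gap has at least `T` ranks strictly inside; together with the left end they give room
    -- for all `T + 1` values of `u`.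
    offset<right : ∀ {t j} (u : Fin (suc T)) → ¬ between t j ℕ.< T →
                   left t j ℕ.+ toℕ u ℕ.< right t j
    offset<right {t} {j} u long = begin-strict
      left t j ℕ.+ toℕ u              ≤⟨ ℕ.+-monoʳ-≤ (left t j)
                                           (ℕ.≤-trans (ℕ.s≤s⁻¹ (Fin.toℕ<n u)) (ℕ.≮⇒≥ long)) ⟩
      left t j ℕ.+ between t j        <⟨ ℕ.n<1+n _ ⟩
      suc (left t j) ℕ.+ between t j  ≡⟨ left+between t j ⟩
      right t j                       ∎
      where open ℕ.≤-Reasoning

    offset<s : ∀ {t j} (u : Fin (suc T)) → ¬ between t j ℕ.< T →
               left t j ℕ.+ toℕ u ℕ.< s
    offset<s {t} {j} u long =
      ℕ.<-trans (offset<right u long) (Fin.toℕ<n (R (hi t) j))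

    -- A short gap is recorded by its left end and length.  In a long gap u marks
    -- one of T + 1 positions, disjoint from those of other long gaps with the same j.
    encode : ∀ t j (u : Fin (suc T)) → Dec (between t j ℕ.< T) → Code
    encode t j u (yes short) = inj₁ (R (lo t) j , fromℕ< short , u)
    encode t j u (no long) = inj₂ (j , fromℕ< (offset<s u long))

    -- Positions lie in half-open intervals from `left` to `right`, which `separated` keeps disjoint
    -- for different `lo`; for equal `lo` the left end cancels.
    offset-injective : ∀ {t t′} j (u u′ : Fin (suc T)) →
      ¬ between t j ℕ.< T → ¬ between t′ j ℕ.< T →
      left t j ℕ.+ toℕ u ≡ left t′ j ℕ.+ toℕ u′ → t ≡ t′ × u ≡ u′
    offset-injective {t} {t′} j u u′ long long′ eq with Fin.<-cmp (lo t) (lo t′)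
    ... | tri< lt _ _ = contradiction eq (ℕ.<⇒≢ (ℕ.<-≤-trans (offset<right u long)
      (ℕ.≤-trans (separated j lt) (ℕ.m≤m+n _ _))))
    ... | tri> _ _ gt = contradiction (sym eq) (ℕ.<⇒≢ (ℕ.<-≤-trans (offset<right u′ long′)
      (ℕ.≤-trans (separated j gt) (ℕ.m≤m+n _ _))))
    ... | tri≈ _ lo≡ _ with refl ← lo-injective j lo≡ =
      refl , Fin.toℕ-injective (ℕ.+-cancelˡ-≡ (left t j) _ _ eq)

    -- Arbitrary decisions `p` and `p′` let `encode` reduce by matching.
    encode-injective : ∀ {t t′ j j′ u u′} p p′ →
      encode t j u p ≡ encode t′ j′ u′ p′ → (t , j , u) ≡ (t′ , j′ , u′)
    encode-injective {t} {t′} {j} {j′} (yes short) (yes short′) eq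
      with starts , rest ← ,-injective (inj₁-injective eq)
      with gaps , refl ← ,-injective rest
      -- Left end and length recover the right end, the second input of `pair-injective`.
      with refl , refl ← pair-injective {t} {t′} {j} {j′} starts
        (Fin.toℕ-injective (subst₂ _≡_ (left+between t j) (left+between t′ j′)
          (cong₂ (λ x y → suc (toℕ x) ℕ.+ y) starts
            (Fin.fromℕ<-injective _ _ short short′ gaps))))
      = refl
    encode-injective {t} {t′} {j} {j′} {u} {u′} (no long) (no long′) eq
      with refl , offsets ← ,-injective (inj₂-injective eq)
      with refl , refl ← offset-injective {t} {t′} j u u′ long long′
        (Fin.fromℕ<-injective _ _ (offset<s u long) (offset<s u′ long′) offsets)
      = refl

    Triple↣Code : Triple ↣ Code
    Triple↣Code = mk↣ {to = λ (t , j , u) → encode t j u (between t j ℕ.<? T)}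
      (encode-injective _ _)

    -- After division by `T + 1`: at most `s T` short gaps and at most `m s / (T + 1)` long ones.
    count : d ℕ.* (m ℕ.* suc T) ℕ.≤ s ℕ.* (T ℕ.* suc T) ℕ.+ m ℕ.* s
    count = Fin.injective⇒≤ (Injection.injective
      (↔⇒↣ (↔-sym code) ↣-∘ (Triple↣Code ↣-∘ ↔⇒↣ triple)))
      where
      triple : Fin (d ℕ.* (m ℕ.* suc T)) ↔ Triple
      triple = (↔-id _ ×-↔ Fin.*↔×) ↔-∘ Fin.*↔×
      code : Fin (s ℕ.* (T ℕ.* suc T) ℕ.+ m ℕ.* s) ↔ Code
      code = (((↔-id _ ×-↔ Fin.*↔×) ↔-∘ Fin.*↔×) ⊎-↔ Fin.*↔×) ↔-∘ Fin.+↔⊎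

  -- T = ⌊2s/d⌋ makes the contribution m s of the long gaps at most half of the total.
  d²m≤4s² : d ℕ.* d ℕ.* m ℕ.≤ 4 ℕ.* (s ℕ.* s)
  d²m≤4s² = optimise d count
    where
    -- `d` is abstracted so that it can be matched on: the choice of `T` divides by it.
    optimise : ∀ d → (∀ T → d ℕ.* (m ℕ.* suc T) ℕ.≤ s ℕ.* (T ℕ.* suc T) ℕ.+ m ℕ.* s) →
               d ℕ.* d ℕ.* m ℕ.≤ 4 ℕ.* (s ℕ.* s)
    optimise zero _ = z≤n
    optimise d@(suc _) bound = begin
      d ℕ.* d ℕ.* m                ≡⟨ ℕ.*-assoc d d m ⟩
      d ℕ.* (d ℕ.* m)              ≤⟨ ℕ.*-monoʳ-≤ d dm≤2sT ⟩
      d ℕ.* (2 ℕ.* s ℕ.* T)        ≡⟨ solve 3 (λ d s T →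
                                        d :* (con 2 :* s :* T) := con 2 :* s :* (T :* d)) refl d s T ⟩
      2 ℕ.* s ℕ.* (T ℕ.* d)        ≤⟨ ℕ.*-monoʳ-≤ (2 ℕ.* s) (m/n*n≤m (2 ℕ.* s) d) ⟩
      2 ℕ.* s ℕ.* (2 ℕ.* s)        ≡⟨ solve 1 (λ s →
                                        con 2 :* s :* (con 2 :* s) := con 4 :* (s :* s)) refl s ⟩
      4 ℕ.* (s ℕ.* s)              ∎
      where
      open ℕ.≤-Reasoning
      open ℕ.+-*-Solver
      T = 2 ℕ.* s ℕ./ d
      2s≤d[1+T] : 2 ℕ.* s ℕ.≤ d ℕ.* suc T
      2s≤d[1+T] = begin
        2 ℕ.* s                      ≡⟨ m≡m%n+[m/n]*n (2 ℕ.* s) d ⟩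
        2 ℕ.* s ℕ.% d ℕ.+ T ℕ.* d    ≤⟨ ℕ.+-monoˡ-≤ (T ℕ.* d) (ℕ.<⇒≤ (m%n<n (2 ℕ.* s) d)) ⟩
        suc T ℕ.* d                  ≡⟨ ℕ.*-comm (suc T) d ⟩
        d ℕ.* suc T                  ∎
      dm≤2sT : d ℕ.* m ℕ.≤ 2 ℕ.* s ℕ.* T
      -- Twice `count` has the term `2 m s`, which `2s≤d[1+T]` bounds by one copy of `d m (T + 1)`.
      -- That copy cancels, and then the factor `T + 1`.
      dm≤2sT = ℕ.*-cancelʳ-≤ (d ℕ.* m) (2 ℕ.* s ℕ.* T) (suc T)
        (ℕ.+-cancelʳ-≤ (d ℕ.* (m ℕ.* suc T)) _ _ (begin
          d ℕ.* m ℕ.* suc T ℕ.+ d ℕ.* (m ℕ.* suc T)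
            ≡⟨ solve 3 (λ d m T → d :* m :* T :+ d :* (m :* T) := con 2 :* (d :* (m :* T)))
                 refl d m (suc T) ⟩
          2 ℕ.* (d ℕ.* (m ℕ.* suc T))
            ≤⟨ ℕ.*-monoʳ-≤ 2 (bound T) ⟩
          2 ℕ.* (s ℕ.* (T ℕ.* suc T) ℕ.+ m ℕ.* s)
            ≡⟨ solve 4 (λ s T T′ m → con 2 :* (s :* (T :* T′) :+ m :* s) :=
                 con 2 :* s :* T :* T′ :+ m :* (con 2 :* s)) refl s T (suc T) m ⟩
          2 ℕ.* s ℕ.* T ℕ.* suc T ℕ.+ m ℕ.* (2 ℕ.* s)
            ≤⟨ ℕ.+-monoʳ-≤ (2 ℕ.* s ℕ.* T ℕ.* suc T) (ℕ.*-monoʳ-≤ m 2s≤d[1+T]) ⟩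
          2 ℕ.* s ℕ.* T ℕ.* suc T ℕ.+ m ℕ.* (d ℕ.* suc T)
            ≡⟨ cong (2 ℕ.* s ℕ.* T ℕ.* suc T ℕ.+_)
                 (solve 3 (λ m d T → m :* (d :* T) := d :* (m :* T)) refl m d (suc T)) ⟩
          2 ℕ.* s ℕ.* T ℕ.* suc T ℕ.+ d ℕ.* (m ℕ.* suc T) ∎))

-- Ranks in a finite strict order.

module Rank {s : ℕ} {_≺_ : Rel (Fin s) 0ℓ} (_≺?_ : Decidable _≺_)
  (irrefl : ∀ {i} → ¬ i ≺ i) (≺-trans : Transitive _≺_) where

  below : Fin s → Subset s
  below i = tabulate λ j → does (j ≺? i)

  ∈-below : ∀ {i j} → j ≺ i → j ∈ below i
  ∈-below {i} {j} j≺i = lookup⇒[]= j (below i)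
    (trans
      (lookup∘tabulate (λ j → does (j ≺? i)) j) (dec-true (j ≺? i) j≺i))

  below-∈ : ∀ {i j} → j ∈ below i → j ≺ i
  below-∈ {i} {j} j∈ with j ≺? i | trans
    (sym (lookup∘tabulate (λ j → does (j ≺? i)) j)) ([]=⇒lookup j∈)
  ... | yes j≺i | _ = j≺i
  ... | no _ | ()

  ∣below∣<s : ∀ i → ∣ below i ∣ ℕ.< s
  ∣below∣<s i = subst (∣ below i ∣ ℕ.<_) (∣⊤∣≡n s)
    (p⊂q⇒∣p∣<∣q∣ ((λ _ → ∈⊤) , i , ∈⊤ , irrefl ∘ below-∈))

  rank : Fin s → Fin s
  rank i = fromℕ< (∣below∣<s i)

  -- Transitivity puts the predecessors of `i` among those of `j`; `i` itself makes the inclusion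
  -- strict.
  rank-mono : ∀ {i j} → i ≺ j → rank i Fin.< rank j
  rank-mono {i} {j} i≺j = subst₂ ℕ._<_
    (sym (Fin.toℕ-fromℕ< (∣below∣<s i))) (sym (Fin.toℕ-fromℕ< (∣below∣<s j)))
    (p⊂q⇒∣p∣<∣q∣
      ((λ x∈ → ∈-below (≺-trans (below-∈ x∈) i≺j)) , i , ∈-below i≺j , irrefl ∘ below-∈))

-- Rational estimates.

⅓ : ℚ
⅓ = + 1 ℚ./ 3

*-pos : ∀ {p q} → 0ℚ ℚ.< p → 0ℚ ℚ.< q → 0ℚ ℚ.< p ℚ.* q
*-pos {p} {q} 0<p 0<q = subst (ℚ._< p ℚ.* q) (ℚ.*-zeroʳ p)
  (ℚ.*-monoʳ-<-pos p {{ℚ.positive 0<p}} 0<q)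

p≤∣p∣ : ∀ p → p ℚ.≤ ℚ.∣ p ∣
p≤∣p∣ p with ℚ.≤-total 0ℚ p
... | inj₁ 0≤p = ℚ.≤-reflexive (sym (ℚ.0≤p⇒∣p∣≡p 0≤p))
... | inj₂ p≤0 = ℚ.≤-trans p≤0 (ℚ.0≤∣p∣ p)

p<q+r⇒p-r<q : ∀ {p q r} → p ℚ.< q ℚ.+ r → p ℚ.- r ℚ.< q
p<q+r⇒p-r<q {p} {q} {r} p<q+r = subst (p ℚ.- r ℚ.<_)
  (solve 2 (λ q r → q :+ r :- r := q) refl q r) (ℚ.+-monoˡ-< (ℚ.- r) p<q+r)
  where open ℚ.+-*-Solver

∣p-q∣<r⇒p<q+r : ∀ p q {r} → ℚ.∣ p ℚ.- q ∣ ℚ.< r → p ℚ.< q ℚ.+ r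
∣p-q∣<r⇒p<q+r p q {r} close = subst (ℚ._< q ℚ.+ r)
  (solve 2 (λ p q → q :+ (p :- q) := p) refl p q)
  (ℚ.+-monoʳ-< q (ℚ.≤-<-trans (p≤∣p∣ (p ℚ.- q)) close))
  where open ℚ.+-*-Solver

p<q+r⇒∣p-q∣<r : ∀ {p q r} → p ℚ.< q ℚ.+ r → q ℚ.< p ℚ.+ r → ℚ.∣ p ℚ.- q ∣ ℚ.< r
p<q+r⇒∣p-q∣<r {p} {q} {r} p< q< with ℚ.∣p∣≡p∨∣p∣≡-p (p ℚ.- q)
... | inj₁ eq = subst (ℚ._< r) (sym eq)
  (p<q+r⇒p-r<q (subst (p ℚ.<_) (ℚ.+-comm q r) p<))
... | inj₂ eq = subst (ℚ._< r)
  (trans (solve 2 (λ p q → q :- p := :- (p :- q)) refl p q) (sym eq))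
  (p<q+r⇒p-r<q (subst (q ℚ.<_) (ℚ.+-comm p r) q<))
  where open ℚ.+-*-Solver

-- Two endpoints each lose less than a third of the gap, so a third survives. This serves both for
-- replacing reals by equal ones and for changing the index in a Cauchy sequence.
gap-perturb : ∀ {p p′ q q′ ε} → ℚ.∣ p′ ℚ.- p ∣ ℚ.< ⅓ ℚ.* ε → ℚ.∣ q ℚ.- q′ ∣ ℚ.< ⅓ ℚ.* ε →
              p ℚ.+ ε ℚ.≤ q → p′ ℚ.+ ⅓ ℚ.* ε ℚ.≤ q′
gap-perturb {p} {p′} {q} {q′} {ε} p′~p q~q′ gap = begin
  p′ ℚ.+ ⅓ ℚ.* ε                ≤⟨ ℚ.+-monoˡ-≤ (⅓ ℚ.* ε) (ℚ.<⇒≤ (∣p-q∣<r⇒p<q+r p′ p p′~p)) ⟩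
  p ℚ.+ ⅓ ℚ.* ε ℚ.+ ⅓ ℚ.* ε     ≡⟨ solve 2 (λ p e → p :+ con ⅓ :* e :+ con ⅓ :* e :=
                                             p :+ e :- con ⅓ :* e) refl p ε ⟩
  p ℚ.+ ε ℚ.- ⅓ ℚ.* ε           ≤⟨ ℚ.+-monoˡ-≤ (ℚ.- (⅓ ℚ.* ε)) gap ⟩
  q ℚ.- ⅓ ℚ.* ε                 ≤⟨ ℚ.<⇒≤ (p<q+r⇒p-r<q (∣p-q∣<r⇒p<q+r q q′ q~q′)) ⟩
  q′                            ∎
  where
  open ℚ.≤-Reasoning
  open ℚ.+-*-Solver

-- Order and equality of Cauchy reals.

both : ∀ {P Q : ℕ → Set} → Eventually P → Eventually Q → Eventually λ n → P n × Q n
both (M , p) (N , q) = M ℕ.⊔ N , λ n ≤n →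
  p n (ℕ.m⊔n≤o⇒m≤o M N ≤n) , q n (ℕ.m⊔n≤o⇒n≤o M N ≤n)

<-irrefl : ∀ x → ¬ x < x
<-irrefl x x<x = <⇒≉ {x} {x} x<x (≈-refl {x})

<-trans : ∀ {x y z} → x < y → y < z → x < z
<-trans {x} {y} {z} (ε , 0<ε , p) (η , 0<η , q) =
  let N , pq = both p q
  in ε , 0<ε , N , λ n ≤n → ℚ.≤-trans (proj₁ (pq n ≤n)) (ℚ.≤-trans
       (subst (ℚ._≤ seq y n ℚ.+ η) (ℚ.+-identityʳ (seq y n))
         (ℚ.+-monoʳ-≤ (seq y n) (ℚ.<⇒≤ 0<η)))
       (proj₂ (pq n ≤n)))

<-resp-≈ : ∀ {x x′ y y′} → x′ ≈ x → y ≈ y′ → x < y → x′ < y′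
<-resp-≈ {x} {x′} {y} {y′} x′≈x y≈y′ (ε , 0<ε , p) =
  let 0<⅓ε = *-pos (ℚ.positive⁻¹ ⅓) 0<ε
      N , q = both p (both (x′≈x (⅓ ℚ.* ε) 0<⅓ε) (y≈y′ (⅓ ℚ.* ε) 0<⅓ε))
  in ⅓ ℚ.* ε , 0<⅓ε , N , λ n ≤n → let gap , x′~x , y~y′ = q n ≤n in
       gap-perturb {seq x n} {seq x′ n} {seq y n} {seq y′ n} x′~x y~y′ gap

+-monoˡ-< : ∀ z {x y} → x < y → x + z < y + z
+-monoˡ-< z {x} {y} (ε , 0<ε , N , p) = ε , 0<ε , N , λ n ≤n →
  subst (ℚ._≤ seq y n ℚ.+ seq z n)
    (solve 3 (λ x e z → x :+ e :+ z := x :+ z :+ e) refl (seq x n) ε (seq z n))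
    (ℚ.+-monoˡ-≤ (seq z n) (p n ≤n))
  where open ℚ.+-*-Solver

-- Past the Cauchy moduli, a gap `ε` at one index would persist as `⅓ ε` at all of them and prove a
-- strict inequality.
≮⇒≈ : ∀ {x y} → ¬ x < y → ¬ y < x → x ≈ y
≮⇒≈ {x} {y} x≮y y≮x ε 0<ε =
  let N , p = both (below x y x≮y) (below y x y≮x)
  in N , λ n ≤n → p<q+r⇒∣p-q∣<r (proj₂ (p n ≤n)) (proj₁ (p n ≤n))
  where
  0<⅓ε : 0ℚ ℚ.< ⅓ ℚ.* ε
  0<⅓ε = *-pos (ℚ.positive⁻¹ ⅓) 0<ε
  below : ∀ x y → ¬ x < y → Eventually λ n → seq y n ℚ.< seq x n ℚ.+ ε
  below x y x≮y =
    let M , p = cauchy x (⅓ ℚ.* ε) 0<⅓ε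
        N , q = cauchy y (⅓ ℚ.* ε) 0<⅓ε
    in M ℕ.⊔ N , λ n ≤n → ℚ.≰⇒> λ gap → x≮y (⅓ ℚ.* ε , 0<⅓ε , M ℕ.⊔ N , λ n′ ≤n′ →
         gap-perturb {seq x n} {seq x n′} {seq y n} {seq y n′}
           (p n′ n (ℕ.m⊔n≤o⇒m≤o M N ≤n′) (ℕ.m⊔n≤o⇒m≤o M N ≤n))
           (q n n′ (ℕ.m⊔n≤o⇒n≤o M N ≤n) (ℕ.m⊔n≤o⇒n≤o M N ≤n′)) gap)

-- Turns additive cancellation into a ring identity on each term, which the solver can check.
≈-by-subtraction : ∀ {x x′ y y′ z z′} → x ≈ x′ → y ≈ y′ →
  (∀ n → seq z n ℚ.- seq z′ n ≡
         (seq x n ℚ.- seq x′ n) ℚ.- (seq y n ℚ.- seq y′ n)) →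
  z ≈ z′
≈-by-subtraction {x} {x′} {y} {y′} x≈x′ y≈y′ eq ε 0<ε =
  let 0<½ε = *-pos (ℚ.positive⁻¹ ½) 0<ε
      N , p = both (x≈x′ (½ ℚ.* ε) 0<½ε) (y≈y′ (½ ℚ.* ε) 0<½ε)
  in N , λ n ≤n → subst₂ ℚ._<_ (cong ℚ.∣_∣ (sym (eq n)))
       (solve 1 (λ e → con ½ :* e :+ con ½ :* e := e) refl ε)
       (ℚ.≤-<-trans
         (ℚ.∣p-q∣≤∣p∣+∣q∣ (seq x n ℚ.- seq x′ n) (seq y n ℚ.- seq y′ n))
         (ℚ.+-mono-< (proj₁ (p n ≤n)) (proj₂ (p n ≤n))))
  where open ℚ.+-*-Solver

+-cancelˡ-≈ : ∀ x {y y′} → x + y ≈ x + y′ → y ≈ y′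
+-cancelˡ-≈ x {y} {y′} eq = ≈-by-subtraction {x + y} {x + y′} {x} {x} {y} {y′} eq
  (≈-refl {x}) λ n → solve 3 (λ x y y′ →
    y :- y′ := (x :+ y :- (x :+ y′)) :- (x :- x)) refl (seq x n) (seq y n) (seq y′ n)
  where open ℚ.+-*-Solver

-- Each translation cancels on its own side, so the ends of a pair determine the difference before
-- `z` and `z′` are compared.
difference-≈ : ∀ {x x′ y y′ z z′} → x + z ≈ x′ + z′ → y + z ≈ y′ + z′ → y - x ≈ y′ - x′
difference-≈ {x} {x′} {y} {y′} {z} {z′} x+z y+z =
  ≈-by-subtraction {y + z} {y′ + z′} {x + z} {x′ + z′} {y - x} {y′ - x′} y+z x+z
    λ n → solve 6 (λ x x′ y y′ z z′ →
      (y :- x) :- (y′ :- x′) :=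
      (y :+ z :- (y′ :+ z′)) :- (x :+ z :- (x′ :+ z′)))
      refl (seq x n) (seq x′ n) (seq y n) (seq y′ n) (seq z n) (seq z′ n)
  where open ℚ.+-*-Solver

-- Double negation commutes with finite products, so excluded middle for each pair gives it for all
-- pairs at once.
¬¬-decidable-< : ∀ {n} (f : Fin n → ℝ) → ¬ ¬ (∀ i j → Dec (f i < f j))
¬¬-decidable-< f = choose λ i → choose λ j → ¬¬-excluded-middle
  where
  choose : ∀ {n} {P : Pred (Fin n) 0ℓ} → (∀ i → ¬ ¬ P i) → ¬ ¬ (∀ i → P i)
  choose = Fin.sequence (RawMonad.rawApplicative ¬¬-Monad)

-- From the integer inequality to real square roots.

square-cancel-≤ : ∀ {m n} → m ℕ.* m ℕ.≤ n ℕ.* n → m ℕ.≤ n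
square-cancel-≤ mm≤nn = ℕ.≮⇒≥ λ n<m → ℕ.<⇒≱ (ℕ.*-mono-< n<m n<m) mm≤nn

√approx-nonNeg : ∀ m n → ℚ.NonNegative (√approx m n)
√approx-nonNeg m n = ℚ.nonNeg*nonNeg⇒nonNeg
  (+ r ℚ./ 1) {{ℚ.normalize-nonNeg r 1}} (+ 1 ℚ./ suc n) {{ℚ.normalize-nonNeg 1 (suc n)}}
  where r = isqrt (m ℕ.* (suc n ℕ.* suc n))

-- Clearing denominators leaves `b r ≤ a (j + 1) N` with `r = ⌊√(m N²)⌋` and `N = n + 1`. This holds
-- after squaring, at every index, because `r² ≤ m N²`.
√approx-bound : ∀ j b a m n →
  b ℕ.* b ℕ.* m ℕ.≤ (a ℕ.* suc j) ℕ.* (a ℕ.* suc j) →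
  (+ 1 ℚ./ suc j) ℚ.* (+ b ℚ./ 1) ℚ.* √approx m n ℚ.≤ + a ℚ./ 1
√approx-bound j b a m n bbm≤ = ℚ.toℚᵘ-cancel-≤
  (ℚᵘ.≤-respˡ-≃ (ℚᵘ.≃-sym lhs) (ℚᵘ.≤-respʳ-≃ (ℚᵘ.≃-sym (fraction (+ a) 0))
    (ℚᵘ.*≤* (subst₂ ℤ._≤_ (sym numerator) (sym denominator) (ℤ.+≤+ br≤)))))
  where
  N = suc n
  r = isqrt (m ℕ.* (N ℕ.* N))

  fraction : ∀ p q → ℚ.toℚᵘ (p ℚ./ suc q) ℚᵘ.≃ ℚᵘ.mkℚᵘ p q
  fraction p q = ℚ.toℚᵘ-fromℚᵘ (ℚᵘ.mkℚᵘ p q)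

  lhs : ℚ.toℚᵘ ((+ 1 ℚ./ suc j) ℚ.* (+ b ℚ./ 1) ℚ.* √approx m n) ℚᵘ.≃
        ℚᵘ.mkℚᵘ (+ 1) j ℚᵘ.* ℚᵘ.mkℚᵘ (+ b) 0 ℚᵘ.*
        (ℚᵘ.mkℚᵘ (+ r) 0 ℚᵘ.* ℚᵘ.mkℚᵘ (+ 1) n)
  lhs = ℚᵘ.≃-trans (ℚ.toℚᵘ-homo-* ((+ 1 ℚ./ suc j) ℚ.* (+ b ℚ./ 1)) (√approx m n))
    (ℚᵘ.*-cong
      (ℚᵘ.≃-trans (ℚ.toℚᵘ-homo-* (+ 1 ℚ./ suc j) (+ b ℚ./ 1))
        (ℚᵘ.*-cong (fraction (+ 1) j) (fraction (+ b) 0)))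
      (ℚᵘ.≃-trans (ℚ.toℚᵘ-homo-* (+ r ℚ./ 1) (+ 1 ℚ./ N))
        (ℚᵘ.*-cong (fraction (+ r) 0) (fraction (+ 1) n))))

  numerator : (+ 1 ℤ.* + b ℤ.* (+ r ℤ.* + 1)) ℤ.* + 1 ≡ + (b ℕ.* r)
  numerator = trans (ℤ.*-identityʳ _) (trans
    (cong₂ ℤ._*_ (ℤ.*-identityˡ (+ b)) (ℤ.*-identityʳ (+ r)))
    (sym (ℤ.pos-* b r)))

  denominator : + a ℤ.* + (suc j ℕ.* 1 ℕ.* (1 ℕ.* N)) ≡ + (a ℕ.* suc j ℕ.* N)
  denominator = trans (sym (ℤ.pos-* a _)) (cong +_ (solve 3
    (λ a j N → a :* (j :* con 1 :* (con 1 :* N)) := a :* j :* N) refl a (suc j) N))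
    where open ℕ.+-*-Solver

  br≤ : b ℕ.* r ℕ.≤ a ℕ.* suc j ℕ.* N
  br≤ = square-cancel-≤ (begin
    b ℕ.* r ℕ.* (b ℕ.* r)
      ≡⟨ solve 2 (λ b r → b :* r :* (b :* r) := b :* b :* (r :* r)) refl b r ⟩
    b ℕ.* b ℕ.* (r ℕ.* r)
      ≤⟨ ℕ.*-monoʳ-≤ (b ℕ.* b) (isqrt-≤ (m ℕ.* (N ℕ.* N))) ⟩
    b ℕ.* b ℕ.* (m ℕ.* (N ℕ.* N))
      ≡⟨ ℕ.*-assoc (b ℕ.* b) m (N ℕ.* N) ⟨
    b ℕ.* b ℕ.* m ℕ.* (N ℕ.* N)
      ≤⟨ ℕ.*-monoˡ-≤ (N ℕ.* N) bbm≤ ⟩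
    a ℕ.* suc j ℕ.* (a ℕ.* suc j) ℕ.* (N ℕ.* N)
      ≡⟨ solve 2 (λ a N → a :* a :* (N :* N) := a :* N :* (a :* N)) refl (a ℕ.* suc j) N ⟩
    a ℕ.* suc j ℕ.* N ℕ.* (a ℕ.* suc j ℕ.* N) ∎)
    where
    open ℕ.≤-Reasoning
    open ℕ.+-*-Solver

-- As v q ≤ 1, exceeding the bound x y ≤ z by ε v costs at most ½ ε in the product.
perturbed-product-< : ∀ {x y z v q w ε} → 0ℚ ℚ.< ε → ℚ.NonNegative q →
  ½ ℚ.* z ℚ.* q ℚ.≤ w → v ℚ.* 1ℚ ℚ.* q ℚ.≤ 1ℚ → x ℚ.* y ℚ.< z ℚ.+ ε ℚ.* v →
  ½ ℚ.* x ℚ.* y ℚ.* q ℚ.< w ℚ.+ ε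
perturbed-product-< {x} {y} {z} {v} {q} {w} {ε} 0<ε 0≤q ½zq≤w vq≤1 xy< = begin-strict
  ½ ℚ.* x ℚ.* y ℚ.* q
    ≡⟨ solve 4 (λ h x y q → h :* x :* y :* q := x :* y :* (h :* q)) refl ½ x y q ⟩
  x ℚ.* y ℚ.* (½ ℚ.* q)
    ≤⟨ ℚ.*-monoʳ-≤-nonNeg (½ ℚ.* q) (ℚ.<⇒≤ xy<) ⟩
  (z ℚ.+ ε ℚ.* v) ℚ.* (½ ℚ.* q)
    ≡⟨ solve 5 (λ h z e v q → (z :+ e :* v) :* (h :* q) :=
         h :* z :* q :+ h :* e :* (v :* con 1ℚ :* q)) refl ½ z ε v q ⟩
  ½ ℚ.* z ℚ.* q ℚ.+ ½ ℚ.* ε ℚ.* (v ℚ.* 1ℚ ℚ.* q)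
    ≤⟨ ℚ.+-mono-≤ ½zq≤w (ℚ.*-monoˡ-≤-nonNeg (½ ℚ.* ε) vq≤1) ⟩
  w ℚ.+ ½ ℚ.* ε ℚ.* 1ℚ
    <⟨ ℚ.+-monoʳ-< w (subst₂ ℚ._<_ (sym (ℚ.*-identityʳ (½ ℚ.* ε))) (ℚ.*-identityˡ ε)
         (ℚ.*-monoˡ-<-pos ε (from-yes (½ ℚ.<? 1ℚ)))) ⟩
  w ℚ.+ ε ∎
  where
  open ℚ.≤-Reasoning
  open ℚ.+-*-Solver
  instance
    ε-pos : ℚ.Positive ε
    ε-pos = ℚ.positive 0<ε
    ½q-nonNeg : ℚ.NonNegative (½ ℚ.* q)
    ½q-nonNeg = ℚ.nonNeg*nonNeg⇒nonNeg ½ q {{0≤q}}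
    ½ε-nonNeg : ℚ.NonNegative (½ ℚ.* ε)
    ½ε-nonNeg = ℚ.nonNegative (ℚ.<⇒≤ (*-pos (ℚ.positive⁻¹ ½) 0<ε))

-- Both real inequalities are negations: a gap `ε` against the conclusion becomes a gap `ε v`
-- against `δ k ≤ d`. The factor `v` has to be independent of the index.
half-√-bound : ∀ δ d k m s → d ℕ.* d ℕ.* m ℕ.≤ 4 ℕ.* (s ℕ.* s) →
  δ * fromℕ k ≤ fromℕ d → fromℚ ½ * δ * fromℕ k * √ m ≤ fromℕ s
half-√-bound δ d k m s ddm≤4ss δk≤d (ε , 0<ε , N , s+ε≤) =
  δk≤d (ε ℚ.* v , *-pos 0<ε (ℚ.positive⁻¹ v {{ℚ.normalize-pos 1 (suc m)}}) ,
    N , λ n ≤n → ℚ.≮⇒≥ λ δk<d+εv → ℚ.<-irrefl refl (ℚ.<-≤-trans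
      (perturbed-product-< {seq δ n} {+ k ℚ./ 1} {+ d ℚ./ 1} {v}
        0<ε (√approx-nonNeg m n) (half-d n) (v√≤1 n) δk<d+εv)
      (s+ε≤ n ≤n)))
  where
  -- √m ≤ m + 1, hence v √m ≤ 1.
  v : ℚ
  v = + 1 ℚ./ suc m

  half-d : ∀ n → ½ ℚ.* (+ d ℚ./ 1) ℚ.* √approx m n ℚ.≤ + s ℚ./ 1
  -- The first argument `1` encodes `½` as `1 / (1 + 1)`.
  half-d n = √approx-bound 1 d s m n (ℕ.≤-trans ddm≤4ss (ℕ.≤-reflexive
    (solve 1 (λ s → con 4 :* (s :* s) := s :* con 2 :* (s :* con 2)) refl s)))
    where open ℕ.+-*-Solver

  v√≤1 : ∀ n → v ℚ.* 1ℚ ℚ.* √approx m n ℚ.≤ 1ℚ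
  v√≤1 n = √approx-bound m 1 1 m n (begin
    1 ℕ.* m                ≡⟨ ℕ.*-identityˡ m ⟩
    m                      ≤⟨ ℕ.n≤1+n m ⟩
    suc m                  ≤⟨ ℕ.m≤m*n (suc m) (suc m) ⟩
    suc m ℕ.* suc m        ≡⟨ cong₂ ℕ._*_ (ℕ.*-identityˡ (suc m)) (ℕ.*-identityˡ (suc m)) ⟨
    1 ℕ.* suc m ℕ.* (1 ℕ.* suc m) ∎)
    where open ℕ.≤-Reasoning

-- Ranking the sumset.

sumset-bound : ∀ {k} (a : Fin k → ℝ) → StrictlyIncreasing a →
  ∀ {d} → HasCard (ConsecutiveDifferences a) d →
  ∀ {B : Pred ℝ 0ℓ} {m} → HasCard B m → ∀ {s} → HasCard (Range a ⊕ B) s →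
  d ℕ.* d ℕ.* m ℕ.≤ 4 ℕ.* (s ℕ.* s)
sumset-bound {k} a a-inc {d} (D , D-inj , D⇔) {B} {m} (b , b-inj , b⇔) {s} (f , f-inj , f⇔) =
  -- An inequality of naturals is stable, so the order on the values of `f` may be assumed
  -- decidable.
  decidable-stable (_ ℕ.≤? _) λ ¬bound →
    ¬¬-decidable-< f (¬bound ∘ bound)
  where
  difference : ∀ t → ConsecutiveDifferences a (D t)
  difference t = Equivalence.from (D⇔ (D t)) (t , ≈-refl {D t})

  lo hi : Fin d → Fin k
  lo t = proj₁ (difference t)
  hi t = proj₁ (proj₂ (difference t))

  D≈ : ∀ t → D t ≈ a (hi t) - a (lo t)
  D≈ t = proj₂ (proj₂ (proj₂ (difference t)))

  position : ∀ i j → Range f (a i + b j)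
  position i j = Equivalence.to (f⇔ (a i + b j))
    (a i , b j , (i , ≈-refl {a i}) , Equivalence.from (b⇔ (b j)) (j , ≈-refl {b j}) ,
     ≈-refl {a i + b j})

  index : Fin k → Fin m → Fin s
  index i j = proj₁ (position i j)

  sum≈ : ∀ i j → a i + b j ≈ f (index i j)
  sum≈ i j = proj₂ (position i j)

  index-mono : ∀ {i i′} j → i Fin.< i′ → f (index i j) < f (index i′ j)
  index-mono {i} {i′} j i<i′ =
    <-resp-≈ {a i + b j} {f (index i j)} {a i′ + b j} {f (index i′ j)}
      (≈-sym {a i + b j} {f (index i j)} (sum≈ i j)) (sum≈ i′ j)
      (+-monoˡ-< (b j) {a i} {a i′} (a-inc {i} {i′} i<i′))

  index-injective : ∀ {i i′ j j′} → index i j ≡ index i′ j′ → a i + b j ≈ a i′ + b j′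
  index-injective {i} {i′} {j} {j′} eq =
    ≈-trans {a i + b j} {f (index i j)} {a i′ + b j′} (sum≈ i j)
      (subst (λ x → f x ≈ a i′ + b j′) (sym eq)
        (≈-sym {a i′ + b j′} {f (index i′ j′)} (sum≈ i′ j′)))

  lo-hi-injective : ∀ {t t′ j j′} → index (lo t) j ≡ index (lo t′) j′ →
                    index (hi t) j ≡ index (hi t′) j′ → t ≡ t′
  lo-hi-injective {t} {t′} {j} {j′} lo≡ hi≡ =
    D-inj {t} {t′} (≈-trans {D t} {Δ} {D t′} (D≈ t)
      (≈-trans {Δ} {Δ′} {D t′}
        (difference-≈ {a (lo t)} {a (lo t′)} {a (hi t)} {a (hi t′)} {b j} {b j′}
          (index-injective {lo t} {lo t′} lo≡) (index-injective {hi t} {hi t′} hi≡))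
        (≈-sym {D t′} {Δ′} (D≈ t′))))
    where
    Δ Δ′ : ℝ
    Δ = a (hi t) - a (lo t)
    Δ′ = a (hi t′) - a (lo t′)

  pair-injective : ∀ {t t′ j j′} → index (lo t) j ≡ index (lo t′) j′ →
                   index (hi t) j ≡ index (hi t′) j′ → t ≡ t′ × j ≡ j′
  pair-injective {t} {t′} {j} {j′} lo≡ hi≡ = t≡t′ ,
    -- Once `t ≡ t′`, both left ends have the summand `a (lo t)`, which cancels.
    b-inj {j} {j′} (+-cancelˡ-≈ (a (lo t)) {b j} {b j′} (index-injective {lo t} {lo t}
      (trans lo≡ (cong (λ t → index (lo t) j′) (sym t≡t′)))))
    where
    t≡t′ : t ≡ t′
    t≡t′ = lo-hi-injective {t} {t′} {j} {j′} lo≡ hi≡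

  bound : (∀ x y → Dec (f x < f y)) → d ℕ.* d ℕ.* m ℕ.≤ 4 ℕ.* (s ℕ.* s)
  bound _<?_ = Counting.d²m≤4s² (λ i j → rank (index i j))
    (λ j i<i′ → rank-mono (index-mono j i<i′)) lo hi
    (λ t → proj₁ (proj₂ (proj₂ (difference t))))
    (λ lo≡ hi≡ → pair-injective (rank-injective lo≡) (rank-injective hi≡))
    where
    open Rank _<?_ (λ {x} → <-irrefl (f x)) (λ {x} {y} {z} → <-trans {f x} {f y} {f z})
    -- Equal ranks exclude both strict orders, so the values of `f` are equal reals, and `f` has no
    -- repetitions.
    rank-injective : Injective _≡_ _≡_ rank
    rank-injective {x} {y} eq = f-inj {x} {y} (≮⇒≈ {f x} {f y}
      (λ lt → Fin.<-irrefl eq (rank-mono lt))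
      (λ gt → Fin.<-irrefl (sym eq) (rank-mono gt)))

theorem2 : ∀ (δ : ℝ) → 0ℝ < δ → δ ≤ 1ℝ →
    ∃[ c ] 0ℝ < c ×
    (∀ (k : ℕ) (a : Fin k → ℝ) → StrictlyIncreasing a →
    ∀ (d : ℕ) → HasCard (ConsecutiveDifferences a) d →
    δ * fromℕ k ≤ fromℕ d →
    ∀ (B : Pred ℝ 0ℓ) (m : ℕ) → HasCard B m → Satisfiable B →
    ∀ (s : ℕ) → HasCard (Range a ⊕ B) s →
    c * fromℕ k * √ m ≤ fromℕ s)
theorem2 δ (ε , 0<ε , N , 0+ε≤δ) _ = fromℚ ½ * δ ,
  (½ ℚ.* ε , *-pos (ℚ.positive⁻¹ ½) 0<ε , N , λ n ≤n → subst (ℚ._≤ ½ ℚ.* seq δ n)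
    (solve 2 (λ h e → h :* (con 0ℚ :+ e) := con 0ℚ :+ h :* e) refl ½ ε)
    (ℚ.*-monoˡ-≤-nonNeg ½ (0+ε≤δ n ≤n))) ,
  λ k a a-inc d D-card δk≤d B m B-card _ s S-card →
    half-√-bound δ d k m s (sumset-bound a a-inc D-card {B} B-card S-card) δk≤d
  where open ℚ.+-*-Solver
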